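{- Learning an unknown LPTS is undecidable in the active learning framework even when the teacher satisfies the friendly-teacher condition and the learner satisfies the minimality condition: there is no learner satisfying the minimality condition such that, for every target LPTS $U$ and every teacher for $U$ satisfying the friendly-teacher condition, the learner after finitely many rounds conjectures a hypothesis $H$ with $H\simeq U$.
   Context: All probabilities are rationals. $\mathrm{Dist}(S)$: discrete distributions on $S$, $\mathrm{supp}(\mu)=\{s\mid\mu(s)>0\}$. An LPTS is $\langle S,s^0,\alpha,\tau\rangle$, finite $S$, start state $s^0$, finite actions $\alpha$, finite $\tau\subseteq S\times\alpha\times\mathrm{Dist}(S)$; $s\xrightarrow{a}\mu$ means $(s,a,\mu)\in\tau$. A tree is an LPTS whose start state (root) is in the support of no transition distribution and each other state is in the support of exactly one. $\mu_1\sqsubseteq_R\mu_2$ iff there is a weight function $w:S_1\times S_2\to\mathbb{Q}\cap[0,1]$ with row sums $\mu_1$, column sums $\mu_2$ and $w(s_1,s_2)>0\Rightarrow s_1Rs_2$; $R$ is a strong simulation iff $s_1Rs_2$, $s_1\xrightarrow{a}\mu_1$ imply some $s_2\xrightarrow{a}\mu_2$ with $\mu_1\sqsubseteq_R\mu_2$; $L_1\preceq L_2$ iff a strong simulation relates the start states; $L_1\simeq L_2$ iff $L_1\preceq L_2$ and $L_2\preceq L_1$. Active learning framework: unknown target LPTS $U$; in each round the learner conjectures a hypothesis LPTS $H$, which must be consistent with the sets $\mathcal{P}$ of positive and $\mathcal{N}$ of negative counterexamples received so far (i.e. $P\preceq H$ for all $P\in\mathcal{P}$, $N\not\preceq H$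 for all $N\in\mathcal{N}$); the teacher either confirms $H\simeq U$ (ending the interaction) or returns a tree counterexample $C$, negative if $C\preceq H$ and $C\not\preceq U$, positive if $C\preceq U$ and $C\not\preceq H$. An execution mapping from a tree $C$ to an LPTS $L$ is a total map $M:S_C\to S_L$ with $M(s^0_C)=s^0_L$ such that for every transition $c\xrightarrow{a}\mu_c$ of $C$ there is a transition $M(c)\xrightarrow{a}\mu_L$ of $L$ with $M$ injective on $\mathrm{supp}(\mu_c)$ and $\mu_c(c')=\mu_L(M(c'))$ for all $c'\in\mathrm{supp}(\mu_c)$. Friendly-teacher condition: every positive counterexample has an execution mapping to $U$, and every negative counterexample has an execution mapping to the hypothesis it refutes. Minimality condition on the learner: every conjectured hypothesis has the minimum number of states among all LPTSes consistent with the current $\mathcal{P}$ and $\mathcal{N}$. -}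

module Defs where

open import Data.Nat using (ℕ; zero; suc) renaming (_≤_ to _≤ℕ_)
open import Data.Fin using (Fin)
open import Data.Rational using (ℚ; 0ℚ; 1ℚ; _+_; _≤_; _<_)
open import Data.Vec using (Vec; lookup; tabulate; foldr)
open import Data.List using (List; []; _∷_; _∷ʳ_)
open import Data.List.Membership.Propositional using (_∈_)
open import Data.List.Relation.Unary.All using (All)
open import Data.Product using (Σ; ∃; ∃-syntax; _×_; _,_)
open import Relation.Nullary using (¬_)
open import Relation.Binary.PropositionalEquality using (_≡_)

sumℚ : ∀ {n} → Vec ℚ n → ℚ
sumℚ = foldr _ _+_ 0ℚ

Dist : ℕ → Set
Dist n = Vec ℚ n

IsDist : ∀ {n} → Dist n → Set
IsDist {n} μ = ((s : Fin n) → 0ℚ ≤ lookup μ s) × sumℚ μ ≡ 1ℚ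

InSupp : ∀ {n} → Fin n → Dist n → Set
InSupp s μ = 0ℚ < lookup μ s

-- LPTS.  States are Fin nStates; actions are natural numbers (each LPTS
-- uses only the finitely many actions occurring in its finite list of
-- transitions).  The finite transition relation τ is a list of triples.

Action : Set
Action = ℕ

Trans : ℕ → Set
Trans n = Fin n × Action × Dist n

record LPTS : Set where
  constructor lpts
  field
    nStates : ℕ
    start   : Fin nStates
    trans   : List (Trans nStates)
    wf      : All (λ t → IsDist (Data.Product.proj₂ (Data.Product.proj₂ t))) trans

open LPTS public

IsTree : LPTS → Set
IsTree L =
  (∀ {s a μ} → (s , a , μ) ∈ trans L → ¬ InSupp (start L) μ) ×
  (∀ (s : Fin (nStates L)) → ¬ (s ≡ start L) →
     Σ (Trans (nStates L)) λ t → t ∈ trans L × InSupp s (Data.Product.proj₂ (Data.Product.proj₂ t))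
       × (∀ {t'} → t' ∈ trans L → InSupp s (Data.Product.proj₂ (Data.Product.proj₂ t')) → t' ≡ t))

LiftRel : ∀ {n₁ n₂} → (Fin n₁ → Fin n₂ → Set) → Dist n₁ → Dist n₂ → Set
LiftRel {n₁} {n₂} R μ₁ μ₂ =
  Σ (Fin n₁ → Fin n₂ → ℚ) λ w →
    (∀ s₁ s₂ → 0ℚ ≤ w s₁ s₂ × w s₁ s₂ ≤ 1ℚ) ×
    (∀ s₁ → sumℚ (tabulate (w s₁)) ≡ lookup μ₁ s₁) ×
    (∀ s₂ → sumℚ (tabulate (λ s₁ → w s₁ s₂)) ≡ lookup μ₂ s₂) ×
    (∀ s₁ s₂ → 0ℚ < w s₁ s₂ → R s₁ s₂)

IsStrongSim : (L₁ L₂ : LPTS) → (Fin (nStates L₁) → Fin (nStates L₂) → Set) → Set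
IsStrongSim L₁ L₂ R =
  ∀ s₁ s₂ → R s₁ s₂ → ∀ a μ₁ → (s₁ , a , μ₁) ∈ trans L₁ →
    Σ (Dist (nStates L₂)) λ μ₂ → (s₂ , a , μ₂) ∈ trans L₂ × LiftRel R μ₁ μ₂

infix 4 _≼_ _≃ₛ_

_≼_ : LPTS → LPTS → Set₁
L₁ ≼ L₂ = Σ (Fin (nStates L₁) → Fin (nStates L₂) → Set) λ R →
            IsStrongSim L₁ L₂ R × R (start L₁) (start L₂)

_≃ₛ_ : LPTS → LPTS → Set₁
L₁ ≃ₛ L₂ = L₁ ≼ L₂ × L₂ ≼ L₁

ExecMapping : LPTS → LPTS → Set
ExecMapping C L =
  Σ (Fin (nStates C) → Fin (nStates L)) λ M →
    M (start C) ≡ start L ×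
    (∀ c a μc → (c , a , μc) ∈ trans C →
       Σ (Dist (nStates L)) λ μL → (M c , a , μL) ∈ trans L ×
         (∀ c' c'' → InSupp c' μc → InSupp c'' μc → M c' ≡ M c'' → c' ≡ c'') ×
         (∀ c' → InSupp c' μc → lookup μc c' ≡ lookup μL (M c')))

data Polarity : Set where
  positive negative : Polarity

History : Set
History = List (Polarity × LPTS)

ConsistentWith : LPTS → Polarity × LPTS → Set₁
ConsistentWith H (positive , C) = C ≼ H
ConsistentWith H (negative , C) = ¬ (C ≼ H)

Consistent : LPTS → History → Set₁
Consistent H cs = All (ConsistentWith H) cs

MinimalConsistent : LPTS → History → Set₁
MinimalConsistent H cs =
  Consistent H cs × (∀ H' → Consistent H' cs → nStates H ≤ℕ nStates H')

data Response : Set where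
  confirm : Response
  cex     : Polarity → LPTS → Response

-- A (deterministic) learner maps the counterexamples received so far to its
-- next hypothesis; a teacher maps the hypotheses conjectured so far (the
-- last one being the current one) to its response.
Learner : Set
Learner = History → LPTS

Teacher : Set
Teacher = List LPTS → Response

ValidFriendlyResponse : LPTS → LPTS → Response → Set₁
ValidFriendlyResponse U H confirm = H ≃ₛ U
ValidFriendlyResponse U H (cex negative C) =
  IsTree C × C ≼ H × ¬ (C ≼ U) × ExecMapping C H
ValidFriendlyResponse U H (cex positive C) =
  IsTree C × C ≼ U × ¬ (C ≼ H) × ExecMapping C U

data Status : Set where
  going : History → List LPTS → Status
  done  : Status

step : Learner → Teacher → Status → Status
step L T done = done
step L T (going cs hs) = react (T (hs ∷ʳ L cs))
  where
  react : Response → Status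
  react confirm   = done
  react (cex p C) = going (cs ∷ʳ (p , C)) (hs ∷ʳ L cs)

run : Learner → Teacher → ℕ → Status
run L T zero    = going [] []
run L T (suc n) = step L T (run L T n)

FriendlyTeacherFor : Learner → Teacher → LPTS → Set₁
FriendlyTeacherFor L T U =
  ∀ n cs hs → run L T n ≡ going cs hs →
    ValidFriendlyResponse U (L cs) (T (hs ∷ʳ L cs))

SatisfiesMinimality : Learner → Set₁
SatisfiesMinimality L =
  ∀ U T → FriendlyTeacherFor L T U →
    ∀ n cs hs → run L T n ≡ going cs hs → MinimalConsistent (L cs) cs

LearnsAll : Learner → Set₁
LearnsAll L =
  ∀ U T → FriendlyTeacherFor L T U →
    ∃[ n ] Σ History λ cs → Σ (List LPTS) λ hs →
      run L T n ≡ going cs hs × L cs ≃ₛ U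

{-# OPTIONS --safe #-}
module Submission where

-- The target U is the seven-state tree
--
--     0 -α-> 1,   0 -β-> 3,   0 -δ-> 2,   1 -β-> 4,   2 -β-> 5,   2 -γ-> 6,
--
-- all of whose transitions are Dirac.  Every LPTS H ≃ U has at least four states.  For 0 < p < 1
-- the three-state LPTS F p with transitions
--
--     0 -α-> {0 : p, 1 : 1 - p},   0 -β-> 2,   0 -δ-> 1,   1 -β-> 2,   1 -γ-> 2
--
-- lies above U.  The teacher answers U itself when U ⋠ H, and otherwise unfolds H along one run
-- that U does not allow.  A hypothesis H above U with at most three states always has such a run
-- whose unfolding is simulated by F p for no small p: either F p could follow the run only
-- through its loop, which forces p to be at least the probability of the first step, or the run
-- starts αγ with its first step of probability 1, whereas F p reaches a state doing γ with
-- probability 1 - p only.  So after every round F p is still consistent for small p, minimality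
-- keeps the learner at three states or fewer, and it never conjectures an H ≃ U.

open import Defs
open import Data.Empty using (⊥; ⊥-elim)
import Data.Fin as Fin
open import Data.Fin using (Fin; zero; suc; _↑ˡ_; _↑ʳ_; splitAt)
open import Data.Fin.Patterns using (0F; 1F; 2F; 3F; 4F; 5F; 6F)
import Data.Fin.Properties as Finₚ
open import Data.List using (List; []; _∷_; _∷ʳ_; map; foldl; allFin)
open import Data.List.Membership.Propositional using (_∈_; find; lose)
open import Data.List.Membership.Propositional.Properties using (∈-map⁺; ∈-map⁻; ∈-allFin)
open import Data.List.Properties using (foldl-∷ʳ)
open import Data.List.Relation.Unary.All as All using (All; []; _∷_)
import Data.List.Relation.Unary.All.Properties as Allₚ
open import Data.List.Relation.Unary.Any as Any using (here; there)
open import Data.Maybe using (Maybe; just; nothing)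
import Data.Nat as ℕ
open import Data.Nat using (ℕ; zero; suc)
open import Data.Product using (Σ; ∃; _×_; _,_; proj₁; proj₂)
open import Data.Rational using (ℚ; 0ℚ; 1ℚ; _+_; _-_; -_; _≤_; _<_; _⊓_; _<?_)
import Data.Rational.Properties as ℚₚ
open import Data.Sum using (_⊎_; inj₁; inj₂; [_,_]′)
open import Data.Unit using (⊤; tt)
open import Data.Vec using (Vec; []; _∷_; lookup; tabulate; replicate; _++_; _[_]≔_)
import Data.Vec.Properties as Vecₚ
open import Function using (_∘_; flip)
open import Relation.Binary.Definitions using (tri<; tri≈; tri>)
open import Relation.Binary.PropositionalEquality
  using (_≡_; _≢_; refl; sym; cong; cong₂; subst; module ≡-Reasoning)
  renaming (trans to ≡-trans)
open import Relation.Nullary using (¬_; Dec; yes; no; contradiction)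
open import Relation.Nullary.Decidable using (map′; _×-dec_; _→-dec_)
open import Algebra.Properties.CommutativeMonoid.Sum ℚₚ.+-0-commutativeMonoid
  using (sum; ∑-comm; sum-cong-≗)

private
  variable
    m n : ℕ

-- Finite sums of rationals

sumℚ-tabulate : (f : Fin n → ℚ) → sumℚ (tabulate f) ≡ sum f
sumℚ-tabulate {zero}  f = refl
sumℚ-tabulate {suc n} f = cong (f zero +_) (sumℚ-tabulate (f ∘ suc))

sumℚ-lookup : (v : Vec ℚ n) → sumℚ v ≡ sum (lookup v)
sumℚ-lookup v = ≡-trans (cong sumℚ (sym (Vecₚ.tabulate∘lookup v))) (sumℚ-tabulate (lookup v))

sumℚ-++ : (u : Vec ℚ m) (v : Vec ℚ n) → sumℚ (u ++ v) ≡ sumℚ u + sumℚ v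
sumℚ-++ []      v = sym (ℚₚ.+-identityˡ _)
sumℚ-++ (x ∷ u) v = ≡-trans (cong (x +_) (sumℚ-++ u v)) (sym (ℚₚ.+-assoc x _ _))

sumℚ-zeros : ∀ n → sumℚ (replicate n 0ℚ) ≡ 0ℚ
sumℚ-zeros zero    = refl
sumℚ-zeros (suc n) = ≡-trans (ℚₚ.+-identityˡ _) (sumℚ-zeros n)

sumℚ-update : (v : Vec ℚ n) (i : Fin n) (q : ℚ) →
              sumℚ (v [ i ]≔ q) + lookup v i ≡ sumℚ v + q
sumℚ-update (x ∷ v) zero q = begin
  (q + sumℚ v) + x  ≡⟨ ℚₚ.+-comm (q + sumℚ v) x ⟩
  x + (q + sumℚ v)  ≡⟨ cong (x +_) (ℚₚ.+-comm q _) ⟩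
  x + (sumℚ v + q)  ≡⟨ ℚₚ.+-assoc x _ _ ⟨
  (x + sumℚ v) + q  ∎
  where open ≡-Reasoning
sumℚ-update (x ∷ v) (suc i) q = begin
  (x + sumℚ (v [ i ]≔ q)) + lookup v i  ≡⟨ ℚₚ.+-assoc x _ _ ⟩
  x + (sumℚ (v [ i ]≔ q) + lookup v i)  ≡⟨ cong (x +_) (sumℚ-update v i q) ⟩
  x + (sumℚ v + q)                      ≡⟨ ℚₚ.+-assoc x _ _ ⟨
  (x + sumℚ v) + q                      ∎
  where open ≡-Reasoning

sum-mono-≤ : {f g : Fin n → ℚ} → (∀ i → f i ≤ g i) → sum f ≤ sum g
sum-mono-≤ {zero}  f≤g = ℚₚ.≤-refl
sum-mono-≤ {suc n} f≤g = ℚₚ.+-mono-≤ (f≤g zero) (sum-mono-≤ (f≤g ∘ suc))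

sum-zero : {f : Fin n → ℚ} → (∀ i → f i ≡ 0ℚ) → sum f ≡ 0ℚ
sum-zero {zero}  f≡0 = refl
sum-zero {suc n} f≡0 = ≡-trans (cong₂ _+_ (f≡0 zero) (sum-zero (f≡0 ∘ suc))) (ℚₚ.+-identityˡ 0ℚ)

sum-nonneg : {f : Fin n → ℚ} → (∀ i → 0ℚ ≤ f i) → 0ℚ ≤ sum f
sum-nonneg {zero}  0≤f = ℚₚ.≤-refl
sum-nonneg {suc n} 0≤f = ℚₚ.+-mono-≤ (0≤f zero) (sum-nonneg (0≤f ∘ suc))

sum-single : {f : Fin n → ℚ} (i : Fin n) → (∀ j → j ≢ i → f j ≡ 0ℚ) → sum f ≡ f i
sum-single {f = f} zero    rest =
  ≡-trans (cong (f zero +_) (sum-zero λ j → rest (suc j) λ ())) (ℚₚ.+-identityʳ _)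
sum-single {f = f} (suc i) rest =
  ≡-trans (cong₂ _+_ (rest zero λ ()) (sum-single i λ j j≢i → rest (suc j) (j≢i ∘ Finₚ.suc-injective)))
        (ℚₚ.+-identityˡ _)

term≤sum : {f : Fin n → ℚ} → (∀ i → 0ℚ ≤ f i) → ∀ i → f i ≤ sum f
term≤sum {f = f} 0≤f zero    =
  subst (_≤ sum f) (ℚₚ.+-identityʳ _) (ℚₚ.+-mono-≤ (ℚₚ.≤-refl {f zero}) (sum-nonneg (0≤f ∘ suc)))
term≤sum {f = f} 0≤f (suc i) =
  subst (_≤ sum f) (ℚₚ.+-identityˡ _) (ℚₚ.+-mono-≤ (0≤f zero) (term≤sum (0≤f ∘ suc) i))

<⇒≱ : ∀ {p q} → p < q → ¬ (q ≤ p)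
<⇒≱ p<q q≤p = ℚₚ.<-irrefl refl (ℚₚ.<-≤-trans p<q q≤p)

+-tight : ∀ {p q r s} → p ≤ q → r ≤ s → p + r ≡ q + s → p ≡ q × r ≡ s
+-tight {p} {q} {r} {s} p≤q r≤s eq with ℚₚ.<-cmp p q | ℚₚ.<-cmp r s
... | tri> _ _ q<p | _            = contradiction p≤q (<⇒≱ q<p)
... | _            | tri> _ _ s<r = contradiction r≤s (<⇒≱ s<r)
... | tri< p<q _ _ | _            = contradiction (ℚₚ.+-mono-<-≤ p<q r≤s) (ℚₚ.<-irrefl eq)
... | _            | tri< r<s _ _ = contradiction (ℚₚ.+-mono-≤-< p≤q r<s) (ℚₚ.<-irrefl eq)
... | tri≈ _ p≡q _ | tri≈ _ r≡s _ = p≡q , r≡s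

sum-tight : {f g : Fin n → ℚ} → (∀ i → f i ≤ g i) → sum f ≡ sum g → ∀ i → f i ≡ g i
sum-tight {suc n} f≤g eq i with +-tight (f≤g zero) (sum-mono-≤ (f≤g ∘ suc)) eq
sum-tight {suc n} f≤g eq zero    | eq₀ , _   = eq₀
sum-tight {suc n} f≤g eq (suc i) | _   , eq₊ = sum-tight (f≤g ∘ suc) eq₊ i

≤0⇒≡0 : ∀ {q} → 0ℚ ≤ q → ¬ (0ℚ < q) → q ≡ 0ℚ
≤0⇒≡0 0≤q 0≮q = ℚₚ.≤-antisym (ℚₚ.≮⇒≥ 0≮q) 0≤q

0<1 : 0ℚ < 1ℚ
0<1 = ℚₚ.positive⁻¹ 1ℚ

positive-term : {f : Fin n → ℚ} → (∀ i → 0ℚ ≤ f i) → 0ℚ < sum f → ∃ λ i → 0ℚ < f i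
positive-term {f = f} 0≤f 0<sum with Finₚ.any? (λ i → 0ℚ <? f i)
... | yes found = found
... | no  none  = contradiction 0<sum (ℚₚ.<-irrefl (sym (sum-zero λ i → ≤0⇒≡0 (0≤f i) (none ∘ (i ,_)))))

-- Distributions

sum-dist : (μ : Dist n) → IsDist μ → sum (lookup μ) ≡ 1ℚ
sum-dist μ (_ , eq) = ≡-trans (sym (sumℚ-lookup μ)) eq

dist-nonempty : (μ : Dist n) → IsDist μ → ∃ λ s → InSupp s μ
dist-nonempty μ d@(0≤μ , _) = positive-term 0≤μ (subst (0ℚ <_) (sym (sum-dist μ d)) 0<1)

dist-singleton : (μ : Dist n) → IsDist μ → ∀ {s} → (∀ u → InSupp u μ → u ≡ s) → lookup μ s ≡ 1ℚ
dist-singleton μ d@(0≤μ , _) {s} only =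
  ≡-trans (sym (sum-single s λ u u≢s → ≤0⇒≡0 (0≤μ u) (u≢s ∘ only u))) (sum-dist μ d)

point : Fin n → ℚ → Vec ℚ n
point v q = replicate _ 0ℚ [ v ]≔ q

lookup-point : (v : Fin n) (q : ℚ) → lookup (point v q) v ≡ q
lookup-point v q = Vecₚ.lookup∘update v (replicate _ 0ℚ) q

lookup-point-≢ : {u v : Fin n} (q : ℚ) → u ≢ v → lookup (point v q) u ≡ 0ℚ
lookup-point-≢ {u = u} q u≢v =
  ≡-trans (Vecₚ.lookup∘update′ u≢v (replicate _ 0ℚ) q) (Vecₚ.lookup-replicate u 0ℚ)

supp-point : (u v : Fin n) (q : ℚ) → InSupp u (point v q) → u ≡ v
supp-point u v q 0<u with u Fin.≟ v
... | yes u≡v = u≡v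
... | no  u≢v = contradiction 0<u (ℚₚ.<-irrefl (sym (lookup-point-≢ q u≢v)))

sumℚ-point : (v : Fin n) (q : ℚ) → sumℚ (point v q) ≡ q
sumℚ-point v q = ≡-trans (sumℚ-lookup (point v q))
  (≡-trans (sum-single v (λ _ → lookup-point-≢ q)) (lookup-point v q))

point-nonneg : {v : Fin n} {q : ℚ} → 0ℚ ≤ q → ∀ u → 0ℚ ≤ lookup (point v q) u
point-nonneg {v = v} {q} 0≤q u with u Fin.≟ v
... | yes refl = subst (0ℚ ≤_) (sym (lookup-point v q)) 0≤q
... | no  u≢v  = ℚₚ.≤-reflexive (sym (lookup-point-≢ q u≢v))

dirac : Fin n → Dist n
dirac v = point v 1ℚ

abstract
  dirac-dist : (v : Fin n) → IsDist (dirac v)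
  dirac-dist v = point-nonneg (ℚₚ.<⇒≤ 0<1) , sumℚ-point v 1ℚ

supp-dirac : (v : Fin n) → InSupp v (dirac v)
supp-dirac v = subst (0ℚ <_) (sym (lookup-point v 1ℚ)) 0<1

-- The leaves of an unfolding are indexed by a support, since a tree has no state of probability 0
-- besides its root. The total is left arbitrary because the enumeration is applied to a
-- distribution with one entry erased.
record SuppEnum (v : Vec ℚ n) : Set where
  field
    size      : ℕ
    at        : Fin size → Fin n
    injective : ∀ i j → at i ≡ at j → i ≡ j
    inSupp    : ∀ i → InSupp (at i) v
    total     : sumℚ (tabulate (lookup v ∘ at)) ≡ sumℚ v

suppEnum : (v : Vec ℚ n) → (∀ s → 0ℚ ≤ lookup v s) → SuppEnum v
suppEnum []      0≤v = record
  { size = 0 ; at = λ () ; injective = λ () ; inSupp = λ () ; total = refl }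
suppEnum (x ∷ v) 0≤v with 0ℚ <? x | suppEnum v (0≤v ∘ suc)
... | yes 0<x | e = record
  { size      = suc size
  ; at        = λ { zero → zero ; (suc i) → suc (at i) }
  ; injective = λ { zero    zero    _  → refl
                  ; (suc i) (suc j) eq → cong suc (injective i j (Finₚ.suc-injective eq)) }
  ; inSupp    = λ { zero → 0<x ; (suc i) → inSupp i }
  ; total     = cong (x +_) total
  }
  where open SuppEnum e
... | no  0≮x | e = record
  { size      = size
  ; at        = suc ∘ at
  ; injective = λ i j eq → injective i j (Finₚ.suc-injective eq)
  ; inSupp    = inSupp
  ; total     = ≡-trans total (≡-trans (sym (ℚₚ.+-identityˡ _)) (cong (_+ sumℚ v) (sym (≤0⇒≡0 (0≤v zero) 0≮x))))
  }
  where open SuppEnum e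

-- Weight functions

module _ {R : Fin m → Fin n → Set} {μ₁ : Dist m} {μ₂ : Dist n} (lift : LiftRel R μ₁ μ₂) where

  private
    w       = proj₁ lift
    0≤w     = λ s₁ s₂ → proj₁ (proj₁ (proj₂ lift) s₁ s₂)
    related = proj₂ (proj₂ (proj₂ (proj₂ lift)))

    row : ∀ s₁ → sum (w s₁) ≡ lookup μ₁ s₁
    row s₁ = ≡-trans (sym (sumℚ-tabulate (w s₁))) (proj₁ (proj₂ (proj₂ lift)) s₁)

    col : ∀ s₂ → sum (λ s₁ → w s₁ s₂) ≡ lookup μ₂ s₂
    col s₂ = ≡-trans (sym (sumℚ-tabulate (λ s₁ → w s₁ s₂))) (proj₁ (proj₂ (proj₂ (proj₂ lift))) s₂)

    w≤μ₁ : ∀ s₁ s₂ → w s₁ s₂ ≤ lookup μ₁ s₁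
    w≤μ₁ s₁ s₂ = subst (w s₁ s₂ ≤_) (row s₁) (term≤sum (0≤w s₁) s₂)

    w≤μ₂ : ∀ s₁ s₂ → w s₁ s₂ ≤ lookup μ₂ s₂
    w≤μ₂ s₁ s₂ = subst (w s₁ s₂ ≤_) (col s₂) (term≤sum (λ i → 0≤w i s₂) s₁)

  lift-right : ∀ {s₁} → InSupp s₁ μ₁ → ∃ λ s₂ → InSupp s₂ μ₂ × R s₁ s₂
  lift-right {s₁} 0<μ with positive-term (0≤w s₁) (subst (0ℚ <_) (sym (row s₁)) 0<μ)
  ... | s₂ , 0<w = s₂ , ℚₚ.<-≤-trans 0<w (w≤μ₂ s₁ s₂) , related s₁ s₂ 0<w

  lift-left : ∀ {s₂} → InSupp s₂ μ₂ → ∃ λ s₁ → InSupp s₁ μ₁ × R s₁ s₂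
  lift-left {s₂} 0<μ with positive-term (λ i → 0≤w i s₂) (subst (0ℚ <_) (sym (col s₂)) 0<μ)
  ... | s₁ , 0<w = s₁ , ℚₚ.<-≤-trans 0<w (w≤μ₁ s₁ s₂) , related s₁ s₂ 0<w

  -- Weight lies only on related pairs inside the supports, so the whole row of `s₁` sits in column
  -- `s₂`, whose sum bounds it.
  lift-mass : ∀ {s₁ s₂} → (∀ u → InSupp u μ₂ → R s₁ u → u ≡ s₂) → lookup μ₁ s₁ ≤ lookup μ₂ s₂
  lift-mass {s₁} {s₂} only = subst (_≤ lookup μ₂ s₂)
    (≡-trans (sym (sum-single s₂ λ u u≢s₂ → ≤0⇒≡0 (0≤w s₁ u) λ 0<w →
                   u≢s₂ (only u (ℚₚ.<-≤-trans 0<w (w≤μ₂ s₁ u)) (related s₁ u 0<w))))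
           (row s₁))
    (w≤μ₂ s₁ s₂)

dist≤1 : (μ : Dist n) → IsDist μ → ∀ s → lookup μ s ≤ 1ℚ
dist≤1 μ d@(0≤μ , _) s = subst (lookup μ s ≤_) (sum-dist μ d) (term≤sum 0≤μ s)

lift-from-dirac : {R : Fin m → Fin n → Set} (v : Fin m) (μ : Dist n) → IsDist μ →
                  (∀ s → InSupp s μ → R v s) → LiftRel R (dirac v) μ
lift-from-dirac {m} {n} {R} v μ d@(0≤μ , _) rel = w , bounds , rows , cols , related
  where
  w : Fin m → Fin n → ℚ
  w u s = lookup (point v (lookup μ s)) u

  bounds : ∀ u s → 0ℚ ≤ w u s × w u s ≤ 1ℚ
  bounds u s with u Fin.≟ v
  ... | yes refl = point-nonneg (0≤μ s) u , subst (_≤ 1ℚ) (sym (lookup-point v _)) (dist≤1 μ d s)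
  ... | no  u≢v  = point-nonneg (0≤μ s) u , subst (_≤ 1ℚ) (sym (lookup-point-≢ _ u≢v)) (ℚₚ.<⇒≤ 0<1)

  rows : ∀ u → sumℚ (tabulate (w u)) ≡ lookup (dirac v) u
  rows u with u Fin.≟ v
  ... | yes refl = ≡-trans (sumℚ-tabulate (w v))
                     (≡-trans (sum-cong-≗ (λ s → lookup-point v (lookup μ s)))
                       (≡-trans (sum-dist μ d) (sym (lookup-point v 1ℚ))))
  ... | no  u≢v  = ≡-trans (sumℚ-tabulate (w u))
                     (≡-trans (sum-zero (λ s → lookup-point-≢ (lookup μ s) u≢v))
                       (sym (lookup-point-≢ 1ℚ u≢v)))

  cols : ∀ s → sumℚ (tabulate (λ u → w u s)) ≡ lookup μ s
  cols s = ≡-trans (cong sumℚ (Vecₚ.tabulate∘lookup (point v (lookup μ s)))) (sumℚ-point v _)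

  related : ∀ u s → 0ℚ < w u s → R u s
  related u s 0<w with supp-point u v _ 0<w
  ... | refl = rel s (subst (0ℚ <_) (lookup-point v _) 0<w)

lift-to-dirac : {R : Fin m → Fin n → Set} (v : Fin n) (μ : Dist m) → IsDist μ →
                (∀ s → InSupp s μ → R s v) → LiftRel R μ (dirac v)
lift-to-dirac {R = R} v μ d rel with lift-from-dirac {R = flip R} v μ d rel
... | w , bounds , rows , cols , related = flip w , flip bounds , cols , rows , flip related

-- Execution mappings as simulations

dist-of : (L : LPTS) → ∀ {s a μ} → (s , a , μ) ∈ trans L → IsDist μ
dist-of L t∈ = All.lookup (wf L) t∈

-- The graph of `M` is a simulation: the weight function moves the whole mass of `c` to `M c`.
exec⇒≼ : (C L : LPTS) → ExecMapping C L → C ≼ L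
exec⇒≼ C L (M , M-start , M-step) = (λ c h → M c ≡ h) , sim , M-start
  where
  sim : IsStrongSim C L (λ c h → M c ≡ h)
  sim c _ refl a μ c∈ with M-step c a μ c∈
  ... | ν , h∈ , inj , agree = ν , h∈ , w , bounds , rows , cols , related
    where
    dμ = dist-of C c∈
    dν = dist-of L h∈

    w : Fin (nStates C) → Fin (nStates L) → ℚ
    w c h = lookup (point (M c) (lookup μ c)) h

    w-off : ∀ {c h} → M c ≢ h → w c h ≡ 0ℚ
    w-off Mc≢h = lookup-point-≢ _ (Mc≢h ∘ sym)

    w-on : ∀ c → w c (M c) ≡ lookup μ c
    w-on c = lookup-point (M c) _

    bounds : ∀ c h → 0ℚ ≤ w c h × w c h ≤ 1ℚ
    bounds c h = point-nonneg (proj₁ dμ c) h ,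
      ℚₚ.≤-trans (subst (w c h ≤_) (≡-trans (sym (sumℚ-lookup (point (M c) _))) (sumℚ-point (M c) _))
                   (term≤sum (point-nonneg (proj₁ dμ c)) h))
                 (dist≤1 μ dμ c)

    row : ∀ c → sum (w c) ≡ lookup μ c
    row c = ≡-trans (sym (sumℚ-lookup (point (M c) (lookup μ c)))) (sumℚ-point (M c) _)

    rows : ∀ c → sumℚ (tabulate (w c)) ≡ lookup μ c
    rows c = ≡-trans (sumℚ-tabulate (w c)) (row c)

    col : Fin (nStates L) → ℚ
    col h = sum (λ c → w c h)

    -- By injectivity at most one supported state lies over `h`. The column sum is therefore its
    -- mass, which agrees with `ν`, or 0.
    col≤ν : ∀ h → col h ≤ lookup ν h
    col≤ν h with Finₚ.any? (λ c → (M c Fin.≟ h) ×-dec (0ℚ <? lookup μ c))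
    ... | yes (c , refl , 0<μ) = ℚₚ.≤-reflexive
            (≡-trans (sum-single c off) (≡-trans (w-on c) (agree c 0<μ)))
      where
      off : ∀ c' → c' ≢ c → w c' (M c) ≡ 0ℚ
      off c' c'≢c with M c' Fin.≟ M c
      ... | no  ≢M = w-off ≢M
      ... | yes ≡M = ≡-trans (cong (w c') (sym ≡M)) (≡-trans (w-on c')
              (≤0⇒≡0 (proj₁ dμ c') λ 0<μ' → c'≢c (inj c' c 0<μ' 0<μ ≡M)))
    ... | no none = subst (_≤ lookup ν h) (sym (sum-zero off)) (proj₁ dν h)
      where
      off : ∀ c' → w c' h ≡ 0ℚ
      off c' with M c' Fin.≟ h
      ... | no  ≢h   = w-off ≢h
      ... | yes refl = ≡-trans (w-on c') (≤0⇒≡0 (proj₁ dμ c') λ 0<μ' → none (c' , refl , 0<μ'))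

    -- Column by column the weights stay below ν, and both sides have total mass 1.
    cols : ∀ h → sumℚ (tabulate (λ c → w c h)) ≡ lookup ν h
    cols h = ≡-trans (sumℚ-tabulate (λ c → w c h)) (sum-tight col≤ν total h)
      where
      total : sum col ≡ sum (lookup ν)
      total = ≡-trans (sym (∑-comm w)) (≡-trans (sum-cong-≗ row) (≡-trans (sum-dist μ dμ) (sym (sum-dist ν dν))))

    related : ∀ c h → 0ℚ < w c h → M c ≡ h
    related c h 0<w = sym (supp-point h (M c) _ 0<w)

-- Runs

Trace : Set
Trace = List (Action × ℚ)

-- The label of a step keeps the probability of the state chosen, because the bounds on `p` are read
-- off the trace.
data Run (L : LPTS) : Fin (nStates L) → Trace → Set where
  halt : ∀ {s} → Run L s []
  move : ∀ {s a μ s' q w} → (s , a , μ) ∈ trans L → InSupp s' μ → lookup μ s' ≡ q →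
         Run L s' w → Run L s ((a , q) ∷ w)

-- An execution mapping whose root goes to an arbitrary `h` instead of the start state, so that
-- trees can be built by induction on a run. The tree retains the run along which it was unfolded.
record Spine (H : LPTS) (h : Fin (nStates H)) (w : Trace) : Set where
  field
    tree    : LPTS
    M       : Fin (nStates tree) → Fin (nStates H)
    M-start : M (start tree) ≡ h
    M-step  : ∀ c a μc → (c , a , μc) ∈ trans tree →
              Σ (Dist (nStates H)) λ μL → (M c , a , μL) ∈ trans H ×
                (∀ c' c'' → InSupp c' μc → InSupp c'' μc → M c' ≡ M c'' → c' ≡ c'') ×
                (∀ c' → InSupp c' μc → lookup μc c' ≡ lookup μL (M c'))
    isTree  : IsTree tree
    spineRun : Run tree (start tree) w

-- Unfolding an LPTS along a run

¬inSupp-zero : {v : Vec ℚ n} {i : Fin n} → lookup v i ≡ 0ℚ → ¬ InSupp i v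
¬inSupp-zero eq 0<v = ℚₚ.<-irrefl (sym eq) 0<v

leafSpine : (H : LPTS) (h : Fin (nStates H)) → Spine H h []
leafSpine H h = record
  { tree    = lpts 1 zero [] []
  ; M       = λ _ → h
  ; M-start = refl
  ; M-step  = λ _ _ _ ()
  ; isTree  = (λ ()) , λ { zero s≢start → contradiction refl s≢start }
  ; spineRun = halt
  }

-- One step is put in front of the tree `T`: a new root moves to the root of `T` in place of `s`,
-- and to a fresh leaf for every other state in the support of `μ`. States are numbered root first,
-- then the `l` leaves, then `T`.
module Graft (H : LPTS) {h a μ s w} (h∈ : (h , a , μ) ∈ trans H) (s∈ : InSupp s μ)
             (spine : Spine H s w) where

  open Spine spine renaming (tree to T)

  private
    dμ : IsDist μ
    dμ = dist-of H h∈

    -- The entry of `s` is erased, since `s` is represented by the root of `T` and must not get a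
    -- leaf as well.
    rest : Vec ℚ (nStates H)
    rest = μ [ s ]≔ 0ℚ

    rest-s : lookup rest s ≡ 0ℚ
    rest-s = Vecₚ.lookup∘update s μ 0ℚ

    rest-other : ∀ {u} → u ≢ s → lookup rest u ≡ lookup μ u
    rest-other u≢s = Vecₚ.lookup∘update′ u≢s μ 0ℚ

    rest-nonneg : ∀ u → 0ℚ ≤ lookup rest u
    rest-nonneg u with u Fin.≟ s
    ... | yes refl = ℚₚ.≤-reflexive (sym rest-s)
    ... | no  u≢s  = subst (0ℚ ≤_) (sym (rest-other u≢s)) (proj₁ dμ u)

    open SuppEnum (suppEnum rest rest-nonneg) renaming (size to l)

    at≢s : ∀ i → at i ≢ s
    at≢s i eq = ¬inSupp-zero {v = rest} rest-s (subst (λ u → InSupp u rest) eq (inSupp i))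

    t = nStates T

    leaf : Fin l → Fin (suc (l ℕ.+ t))
    leaf i = suc (i ↑ˡ t)

    sub : Fin t → Fin (suc (l ℕ.+ t))
    sub j = suc (l ↑ʳ j)

    data Position : Fin (suc (l ℕ.+ t)) → Set where
      at-root : Position zero
      at-leaf : ∀ i → Position (leaf i)
      at-sub  : ∀ j → Position (sub j)

    position : ∀ c → Position c
    position zero = at-root
    position (suc c) with splitAt l c in eq
    ... | inj₁ i = subst (Position ∘ suc) (Finₚ.splitAt⁻¹-↑ˡ eq) (at-leaf i)
    ... | inj₂ j = subst (Position ∘ suc) (Finₚ.splitAt⁻¹-↑ʳ eq) (at-sub j)

    M⁺ : Fin (suc (l ℕ.+ t)) → Fin (nStates H)
    M⁺ zero    = h
    M⁺ (suc c) = [ at , M ]′ (splitAt l c)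

    M⁺-leaf : ∀ i → M⁺ (leaf i) ≡ at i
    M⁺-leaf i = cong [ at , M ]′ (Finₚ.splitAt-↑ˡ l i t)

    M⁺-sub : ∀ j → M⁺ (sub j) ≡ M j
    M⁺-sub j = cong [ at , M ]′ (Finₚ.splitAt-↑ʳ l t j)

    leafMass : Vec ℚ l
    leafMass = tabulate (lookup rest ∘ at)

    ν : Dist (suc (l ℕ.+ t))
    ν = 0ℚ ∷ leafMass ++ point (start T) (lookup μ s)

    ν-leaf : ∀ i → lookup ν (leaf i) ≡ lookup rest (at i)
    ν-leaf i = ≡-trans (Vecₚ.lookup-++ˡ leafMass _ i) (Vecₚ.lookup∘tabulate _ i)

    ν-sub : ∀ j → lookup ν (sub j) ≡ lookup (point (start T) (lookup μ s)) j
    ν-sub = Vecₚ.lookup-++ʳ leafMass _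

    ν-start : lookup ν (sub (start T)) ≡ lookup μ s
    ν-start = ≡-trans (ν-sub (start T)) (lookup-point (start T) _)

    ν-supp-sub : ∀ j → InSupp (sub j) ν → j ≡ start T
    ν-supp-sub j = supp-point j (start T) _ ∘ subst (0ℚ <_) (ν-sub j)

    ν-dist : IsDist ν
    ν-dist = nonneg , (begin
      0ℚ + sumℚ (leafMass ++ point (start T) (lookup μ s))     ≡⟨ ℚₚ.+-identityˡ _ ⟩
      sumℚ (leafMass ++ point (start T) (lookup μ s))          ≡⟨ sumℚ-++ leafMass _ ⟩
      sumℚ leafMass + sumℚ (point (start T) (lookup μ s))      ≡⟨ cong₂ _+_ total (sumℚ-point (start T) _) ⟩
      sumℚ rest + lookup μ s                                   ≡⟨ sumℚ-update μ s 0ℚ ⟩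
      sumℚ μ + 0ℚ                                              ≡⟨ ℚₚ.+-identityʳ _ ⟩
      sumℚ μ                                                   ≡⟨ proj₂ dμ ⟩
      1ℚ                                                       ∎)
      where
      open ≡-Reasoning
      nonneg : ∀ c → 0ℚ ≤ lookup ν c
      nonneg c with position c
      ... | at-root   = ℚₚ.≤-refl
      ... | at-leaf i = subst (0ℚ ≤_) (sym (ν-leaf i)) (rest-nonneg (at i))
      ... | at-sub j  = subst (0ℚ ≤_) (sym (ν-sub j)) (point-nonneg (proj₁ dμ s) j)

    pad : Dist t → Dist (suc (l ℕ.+ t))
    pad ρ = 0ℚ ∷ replicate l 0ℚ ++ ρ

    pad-leaf : ∀ ρ i → lookup (pad ρ) (leaf i) ≡ 0ℚ
    pad-leaf ρ i = ≡-trans (Vecₚ.lookup-++ˡ (replicate l 0ℚ) ρ i) (Vecₚ.lookup-replicate i 0ℚ)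

    pad-sub : ∀ ρ j → lookup (pad ρ) (sub j) ≡ lookup ρ j
    pad-sub ρ = Vecₚ.lookup-++ʳ (replicate l 0ℚ) ρ

    pad-supp⁺ : ∀ ρ j → InSupp j ρ → InSupp (sub j) (pad ρ)
    pad-supp⁺ ρ j = subst (0ℚ <_) (sym (pad-sub ρ j))

    pad-supp⁻ : ∀ ρ j → InSupp (sub j) (pad ρ) → InSupp j ρ
    pad-supp⁻ ρ j = subst (0ℚ <_) (pad-sub ρ j)

    pad-supp : ∀ ρ c → InSupp c (pad ρ) → ∃ λ j → c ≡ sub j × InSupp j ρ
    pad-supp ρ c 0<ρ with position c
    ... | at-root   = contradiction 0<ρ (ℚₚ.<-irrefl refl)
    ... | at-leaf i = contradiction 0<ρ (¬inSupp-zero {v = pad ρ} {leaf i} (pad-leaf ρ i))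
    ... | at-sub j  = j , refl , pad-supp⁻ ρ j 0<ρ

    pad-dist : ∀ {ρ} → IsDist ρ → IsDist (pad ρ)
    pad-dist {ρ} (0≤ρ , sum≡1) = nonneg , (begin
      0ℚ + sumℚ (replicate l 0ℚ ++ ρ)     ≡⟨ ℚₚ.+-identityˡ _ ⟩
      sumℚ (replicate l 0ℚ ++ ρ)          ≡⟨ sumℚ-++ (replicate l 0ℚ) ρ ⟩
      sumℚ (replicate l 0ℚ) + sumℚ ρ      ≡⟨ cong (_+ sumℚ ρ) (sumℚ-zeros l) ⟩
      0ℚ + sumℚ ρ                         ≡⟨ ℚₚ.+-identityˡ _ ⟩
      sumℚ ρ                              ≡⟨ sum≡1 ⟩
      1ℚ                                  ∎)
      where
      open ≡-Reasoning
      nonneg : ∀ c → 0ℚ ≤ lookup (pad ρ) c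
      nonneg c with position c
      ... | at-root   = ℚₚ.≤-refl
      ... | at-leaf i = ℚₚ.≤-reflexive (sym (pad-leaf ρ i))
      ... | at-sub j  = subst (0ℚ ≤_) (sym (pad-sub ρ j)) (0≤ρ j)

    padTrans : Trans t → Trans (suc (l ℕ.+ t))
    padTrans (c , b , ρ) = sub c , b , pad ρ

    grafted : LPTS
    grafted = lpts (suc (l ℕ.+ t)) zero ((zero , a , ν) ∷ map padTrans (trans T))
                   (ν-dist ∷ Allₚ.map⁺ (All.map pad-dist (wf T)))

    data Transition : Trans (suc (l ℕ.+ t)) → Set where
      new : Transition (zero , a , ν)
      old : ∀ {c b ρ} → (c , b , ρ) ∈ trans T → Transition (sub c , b , pad ρ)

    transition : ∀ {x} → x ∈ trans grafted → Transition x
    transition (here refl) = new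
    transition (there x∈) with ∈-map⁻ padTrans x∈
    ... | _ , t∈ , refl = old t∈

    old∈ : ∀ {c b ρ} → (c , b , ρ) ∈ trans T → (sub c , b , pad ρ) ∈ trans grafted
    old∈ t∈ = there (∈-map⁺ padTrans t∈)

    root-fresh : ∀ {c b ρ} → (c , b , ρ) ∈ trans grafted → ¬ InSupp zero ρ
    root-fresh x∈ with transition x∈
    ... | new   = ℚₚ.<-irrefl refl
    ... | old _ = ℚₚ.<-irrefl refl

    -- The leaves and the root of `T` are entered by the new transition only; every other state of
    -- `T` keeps its unique incoming transition, padded with zeros.
    incoming : ∀ c → ¬ (c ≡ zero) →
               Σ (Trans (suc (l ℕ.+ t))) λ x → x ∈ trans grafted × InSupp c (proj₂ (proj₂ x)) ×
                 (∀ {x'} → x' ∈ trans grafted → InSupp c (proj₂ (proj₂ x')) → x' ≡ x)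
    incoming c c≢0 with position c
    ... | at-root   = contradiction refl c≢0
    ... | at-leaf i = _ , here refl , subst (0ℚ <_) (sym (ν-leaf i)) (inSupp i) , unique
      where
      unique : ∀ {x'} → x' ∈ trans grafted → InSupp (leaf i) (proj₂ (proj₂ x')) → x' ≡ (zero , a , ν)
      unique x∈ 0<x with transition x∈
      ... | new             = refl
      ... | old {ρ = ρ} _   = contradiction 0<x (¬inSupp-zero {v = pad ρ} {leaf i} (pad-leaf ρ i))
    ... | at-sub j with j Fin.≟ start T
    ...   | yes refl = _ , here refl , subst (0ℚ <_) (sym ν-start) s∈ , unique
      where
      unique : ∀ {x'} → x' ∈ trans grafted → InSupp (sub (start T)) (proj₂ (proj₂ x')) → x' ≡ (zero , a , ν)
      unique x∈ 0<x with transition x∈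
      ... | new    = refl
      ... | old {ρ = ρ} t∈ = contradiction (pad-supp⁻ ρ _ 0<x) (proj₁ isTree t∈)
    ...   | no j≢start with proj₂ isTree j j≢start
    ...     | x , x∈ , 0<x , x-unique = padTrans x , old∈ x∈ , pad-supp⁺ _ j 0<x , unique
      where
      unique : ∀ {x'} → x' ∈ trans grafted → InSupp (sub j) (proj₂ (proj₂ x')) → x' ≡ padTrans x
      unique x'∈ 0<x' with transition x'∈
      ... | new    = contradiction (ν-supp-sub j 0<x') j≢start
      ... | old {ρ = ρ} t∈ = cong padTrans (x-unique t∈ (pad-supp⁻ ρ j 0<x'))

    -- Leaves lie over distinct states other than `s`, and the only supported state of `T` is its
    -- root, which lies over `s`.
    ν-injective : ∀ c c' → InSupp c ν → InSupp c' ν → M⁺ c ≡ M⁺ c' → c ≡ c'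
    ν-injective c c' 0<c 0<c' eq with position c | position c'
    ... | at-root   | _          = contradiction 0<c (ℚₚ.<-irrefl refl)
    ... | _         | at-root    = contradiction 0<c' (ℚₚ.<-irrefl refl)
    ... | at-leaf i | at-leaf i' =
      cong leaf (injective i i' (≡-trans (sym (M⁺-leaf i)) (≡-trans eq (M⁺-leaf i'))))
    ... | at-leaf i | at-sub j with refl ← ν-supp-sub j 0<c' = contradiction
      (≡-trans (sym (M⁺-leaf i)) (≡-trans eq (≡-trans (M⁺-sub j) M-start))) (at≢s i)
    ν-injective c c' 0<c 0<c' eq | at-sub j | at-leaf i with refl ← ν-supp-sub j 0<c = contradiction
      (≡-trans (sym (M⁺-leaf i)) (≡-trans (sym eq) (≡-trans (M⁺-sub j) M-start))) (at≢s i)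
    ν-injective c c' 0<c 0<c' eq | at-sub j | at-sub j' =
      cong sub (≡-trans (ν-supp-sub j 0<c) (sym (ν-supp-sub j' 0<c')))

    ν-agree : ∀ c → InSupp c ν → lookup ν c ≡ lookup μ (M⁺ c)
    ν-agree c 0<c with position c
    ... | at-root   = contradiction 0<c (ℚₚ.<-irrefl refl)
    ... | at-leaf i =
      ≡-trans (ν-leaf i) (≡-trans (rest-other (at≢s i)) (cong (lookup μ) (sym (M⁺-leaf i))))
    ... | at-sub j with refl ← ν-supp-sub j 0<c =
      ≡-trans ν-start (cong (lookup μ) (sym (≡-trans (M⁺-sub j) M-start)))

    M⁺-step : ∀ c b ρ → (c , b , ρ) ∈ trans grafted →
              Σ (Dist (nStates H)) λ μL → (M⁺ c , b , μL) ∈ trans H ×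
                (∀ c' c'' → InSupp c' ρ → InSupp c'' ρ → M⁺ c' ≡ M⁺ c'' → c' ≡ c'') ×
                (∀ c' → InSupp c' ρ → lookup ρ c' ≡ lookup μL (M⁺ c'))
    M⁺-step c b ρ x∈ with transition x∈
    ... | new = μ , h∈ , ν-injective , ν-agree
    ... | old {c = c₀} {ρ = ρ₀} t∈ with M-step _ _ _ t∈
    ...   | μL , L∈ , inj , agree =
      μL , subst (λ u → (u , b , μL) ∈ trans H) (sym (M⁺-sub c₀)) L∈ , inj⁺ , agree⁺
      where
      inj⁺ : ∀ c' c'' → InSupp c' (pad ρ₀) → InSupp c'' (pad ρ₀) → M⁺ c' ≡ M⁺ c'' → c' ≡ c''
      inj⁺ c' c'' 0<c' 0<c'' eq with pad-supp ρ₀ c' 0<c' | pad-supp ρ₀ c'' 0<c''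
      ... | i , refl , 0<i | j , refl , 0<j =
        cong sub (inj i j 0<i 0<j (≡-trans (sym (M⁺-sub i)) (≡-trans eq (M⁺-sub j))))

      agree⁺ : ∀ c' → InSupp c' (pad ρ₀) → lookup (pad ρ₀) c' ≡ lookup μL (M⁺ c')
      agree⁺ c' 0<c' with pad-supp ρ₀ c' 0<c'
      ... | i , refl , 0<i =
        ≡-trans (pad-sub ρ₀ i) (≡-trans (agree i 0<i) (cong (lookup μL) (sym (M⁺-sub i))))

    run-sub : ∀ {c w'} → Run T c w' → Run grafted (sub c) w'
    run-sub halt = halt
    run-sub (move {μ = ρ} t∈ 0<ρ eq r) =
      move (old∈ t∈) (pad-supp⁺ ρ _ 0<ρ) (≡-trans (pad-sub ρ _) eq) (run-sub r)

  graft : Spine H h ((a , lookup μ s) ∷ w)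
  graft = record
    { tree    = grafted
    ; M       = M⁺
    ; M-start = refl
    ; M-step  = M⁺-step
    ; isTree  = root-fresh , incoming
    ; spineRun = move (here refl) (subst (0ℚ <_) (sym ν-start) s∈) ν-start (run-sub spineRun)
    }

unfoldAlong : (H : LPTS) → ∀ {h w} → Run H h w → Spine H h w
unfoldAlong H halt                = leafSpine H _
unfoldAlong H (move h∈ s∈ refl r) = Graft.graft H h∈ s∈ (unfoldAlong H r)

-- Deterministic specifications of finite depth

data Spec : Set where
  spec : (Action → Maybe Spec) → Spec

Below  : (L : LPTS) → Spec → Fin (nStates L) → Set
Below? : (L : LPTS) → Maybe Spec → Fin (nStates L) → Set
Below L (spec f) s  = ∀ a μ u → (s , a , μ) ∈ trans L → InSupp u μ → Below? L (f a) u
Below? L nothing  s = ⊥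
Below? L (just φ) s = Below L φ s

Rejects  : Spec → Trace → Set
Rejects? : Maybe Spec → Trace → Set
Rejects φ        []            = ⊥
Rejects (spec f) ((a , _) ∷ w) = Rejects? (f a) w
Rejects? nothing  w = ⊤
Rejects? (just φ) w = Rejects φ w

-- The recursion is on the specification, which has finite depth, so cycles of `L` do no harm.
search : (L : LPTS) (φ : Spec) (s : Fin (nStates L)) →
         (∃ λ w → Run L s w × Rejects φ w) ⊎ Below L φ s
search? : (L : LPTS) (φ : Maybe Spec) (s : Fin (nStates L)) →
          (∃ λ w → Run L s w × Rejects? φ w) ⊎ Below? L φ s
search L (spec f) s = conclude (All.decide check (trans L))
  where
  -- The source is compared with `s` inside the predicates, so that one decision runs through the
  -- whole transition list.
  Violation Fine : Trans (nStates L) → Set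
  Violation (s' , a , μ) = s' ≡ s × ∃ λ u → InSupp u μ × ∃ λ w → Run L u w × Rejects? (f a) w
  Fine (s' , a , μ) = s' ≡ s → ∀ u → InSupp u μ → Below? L (f a) u

  check : ∀ t → Fine t ⊎ Violation t
  check (s' , a , μ) with s' Fin.≟ s
  ... | no  s'≢s = inj₁ λ s'≡s → contradiction s'≡s s'≢s
  ... | yes s'≡s with All.decide checkState (allFin (nStates L))
    where
    checkState : ∀ u → (InSupp u μ → Below? L (f a) u) ⊎
                       (InSupp u μ × ∃ λ w → Run L u w × Rejects? (f a) w)
    checkState u with 0ℚ <? lookup μ u | search? L (f a) u
    ... | no  0≮μ | _             = inj₁ λ 0<μ → contradiction 0<μ 0≮μ
    ... | yes _   | inj₂ below    = inj₁ λ _ → below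
    ... | yes 0<μ | inj₁ violated = inj₂ (0<μ , violated)
  ...   | inj₁ fine = inj₁ λ _ u → All.lookup fine (∈-allFin u)
  ...   | inj₂ bad  = inj₂ (s'≡s , Any.satisfied bad)

  conclude : All Fine (trans L) ⊎ Any.Any Violation (trans L) →
             (∃ λ w → Run L s w × Rejects (spec f) w) ⊎ Below L (spec f) s
  conclude (inj₁ fine) = inj₂ λ a μ u t∈ → All.lookup fine t∈ refl u
  conclude (inj₂ bad) with find bad
  ... | (_ , a , μ) , t∈ , refl , u , 0<μ , w , r , rej =
    inj₁ ((a , lookup μ u) ∷ w , move t∈ 0<μ refl r , rej)
search? L nothing  s = inj₁ ([] , halt , tt)
search? L (just φ) s = search L φ s

Closed : (L : LPTS) → (Fin (nStates L) → Spec → Set) → Set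
Closed L S = ∀ {f s a μ u} → S s (spec f) → (s , a , μ) ∈ trans L → InSupp u μ →
             ∃ λ φ → f a ≡ just φ × S u φ

-- An invariant of state-specification pairs that every step preserves suffices, by induction on the
-- depth of the specification.
closed⇒below  : ∀ L {S} → Closed L S → ∀ φ {s} → S s φ → Below L φ s
closed⇒below? : ∀ L {S} → Closed L S → ∀ φ? {s} → (∃ λ φ → φ? ≡ just φ × S s φ) → Below? L φ? s
closed⇒below L cl (spec f) S a μ u t∈ 0<μ = closed⇒below? L cl (f a) (cl S t∈ 0<μ)
closed⇒below? L cl (just φ) (_ , refl , S) = closed⇒below L cl φ S

-- The run is followed through the simulation: each successor in the support has a related one in
-- the support on the right, which still obeys the specification. Hence the trace never leaves it.
simulated-run-accepted :
  ∀ L₁ L₂ {R} → IsStrongSim L₁ L₂ R → ∀ φ {s u w} → R s u → Below L₂ φ u →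
  Run L₁ s w → ¬ Rejects φ w
simulated-run-accepted L₁ L₂ sim (spec f) Rsu below (move {a = a} {μ} t∈ 0<μ _ r) rej
  with sim _ _ Rsu a μ t∈
... | μ₂ , u∈ , lift with lift-right {μ₁ = μ} {μ₂} lift 0<μ
... | u' , 0<μ₂ , Rsu' with f a | below a μ₂ u' u∈ 0<μ₂
... | just φ | below' = simulated-run-accepted L₁ L₂ sim φ Rsu' below' r rej

-- Moves into a given set of states

Can : (L : LPTS) → Action → (Fin (nStates L) → Set) → Fin (nStates L) → Set
Can L a P s = Σ (Dist (nStates L)) λ μ → (s , a , μ) ∈ trans L × (∀ u → InSupp u μ → P u)

can? : ∀ L a {P} → (∀ u → Dec (P u)) → ∀ s → Dec (Can L a P s)
can? L a {P} P? s = map′ to from (Any.any? match? (trans L))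
  where
  Match : Trans (nStates L) → Set
  Match (s' , a' , μ) = s' ≡ s × a' ≡ a × (∀ u → InSupp u μ → P u)

  match? : ∀ t → Dec (Match t)
  match? (s' , a' , μ) =
    (s' Fin.≟ s) ×-dec (a' ℕ.≟ a) ×-dec Finₚ.all? λ u → (0ℚ <? lookup μ u) →-dec P? u

  to : Any.Any Match (trans L) → Can L a P s
  to found with find found
  ... | (_ , _ , μ) , t∈ , refl , refl , all = μ , t∈ , all

  from : Can L a P s → Any.Any Match (trans L)
  from (_ , t∈ , all) = lose t∈ (refl , refl , all)

-- Every state in the support of the answer draws its mass from some state in the support of
-- `dirac v`, which can only be `v`. This is why `Can` constrains all successors.
simulated-can : ∀ L₁ L₂ {R} → IsStrongSim L₁ L₂ R → ∀ {u s a} v → R u s →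
                (u , a , dirac v) ∈ trans L₁ → Can L₂ a (R v) s
simulated-can L₁ L₂ {R} sim v Rus u∈ with sim _ _ Rus _ _ u∈
... | μ , s∈ , lift = μ , s∈ , λ s' 0<μ →
  let c , 0<c , Rcs' = lift-left {μ₁ = dirac v} {μ} lift 0<μ
  in  subst (λ c → R c s') (supp-point c v 1ℚ 0<c) Rcs'

Anything : Fin n → Set
Anything _ = ⊤

anything? : (s : Fin n) → Dec (Anything s)
anything? _ = yes tt

-- A distribution has nonempty support, so any transition yields a successor that would violate the
-- specification.
below-forbids : ∀ L f {a s} → Below L (spec f) s → f a ≡ nothing → ¬ Can L a Anything s
below-forbids L f {a} below fa≡ (μ , t∈ , _) with dist-nonempty μ (dist-of L t∈)
... | u , 0<μ with f a | below a μ u t∈ 0<μ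
... | just _ | _ with () ← fa≡

-- The target

pattern α = 0
pattern β = 1
pattern γ = 2
pattern δ = 3

U : LPTS
U = lpts 7 0F
  ((0F , α , dirac 1F) ∷ (0F , β , dirac 3F) ∷ (0F , δ , dirac 2F) ∷
   (1F , β , dirac 4F) ∷ (2F , β , dirac 5F) ∷ (2F , γ , dirac 6F) ∷ [])
  (dirac-dist 1F ∷ dirac-dist 3F ∷ dirac-dist 2F ∷ dirac-dist 4F ∷ dirac-dist 5F ∷ dirac-dist 6F ∷ [])

data UStep : Trans 7 → Set where
  0-α-1 : UStep (0F , α , dirac 1F)
  0-β-3 : UStep (0F , β , dirac 3F)
  0-δ-2 : UStep (0F , δ , dirac 2F)
  1-β-4 : UStep (1F , β , dirac 4F)
  2-β-5 : UStep (2F , β , dirac 5F)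
  2-γ-6 : UStep (2F , γ , dirac 6F)

uStep : ∀ {t} → t ∈ trans U → UStep t
uStep (here refl)                                         = 0-α-1
uStep (there (here refl))                                 = 0-β-3
uStep (there (there (here refl)))                         = 0-δ-2
uStep (there (there (there (here refl))))                 = 1-β-4
uStep (there (there (there (there (here refl)))))         = 2-β-5
uStep (there (there (there (there (there (here refl)))))) = 2-γ-6

uStep∈ : ∀ {t} → UStep t → t ∈ trans U
uStep∈ 0-α-1 = here refl
uStep∈ 0-β-3 = there (here refl)
uStep∈ 0-δ-2 = there (there (here refl))
uStep∈ 1-β-4 = there (there (there (here refl)))
uStep∈ 2-β-5 = there (there (there (there (here refl))))
uStep∈ 2-γ-6 = there (there (there (there (there (here refl)))))

U-isTree : IsTree U
U-isTree = root-fresh , incoming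
  where
  root-fresh : ∀ {s a μ} → (s , a , μ) ∈ trans U → ¬ InSupp 0F μ
  root-fresh t∈ 0<μ with uStep t∈
  ... | 0-α-1 with () ← supp-point {7} 0F 1F 1ℚ 0<μ
  ... | 0-β-3 with () ← supp-point {7} 0F 3F 1ℚ 0<μ
  ... | 0-δ-2 with () ← supp-point {7} 0F 2F 1ℚ 0<μ
  ... | 1-β-4 with () ← supp-point {7} 0F 4F 1ℚ 0<μ
  ... | 2-β-5 with () ← supp-point {7} 0F 5F 1ℚ 0<μ
  ... | 2-γ-6 with () ← supp-point {7} 0F 6F 1ℚ 0<μ

  into : Fin 7 → Trans 7
  -- The root has no incoming transition; its value is a placeholder, and `exists` excludes this
  -- case.
  into 0F = 0F , α , dirac 1F
  into 1F = 0F , α , dirac 1F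
  into 2F = 0F , δ , dirac 2F
  into 3F = 0F , β , dirac 3F
  into 4F = 1F , β , dirac 4F
  into 5F = 2F , β , dirac 5F
  into 6F = 2F , γ , dirac 6F

  unique : ∀ {s t} → UStep t → InSupp s (proj₂ (proj₂ t)) → t ≡ into s
  unique {s} 0-α-1 0<μ with refl ← supp-point s 1F 1ℚ 0<μ = refl
  unique {s} 0-β-3 0<μ with refl ← supp-point s 3F 1ℚ 0<μ = refl
  unique {s} 0-δ-2 0<μ with refl ← supp-point s 2F 1ℚ 0<μ = refl
  unique {s} 1-β-4 0<μ with refl ← supp-point s 4F 1ℚ 0<μ = refl
  unique {s} 2-β-5 0<μ with refl ← supp-point s 5F 1ℚ 0<μ = refl
  unique {s} 2-γ-6 0<μ with refl ← supp-point s 6F 1ℚ 0<μ = refl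

  exists : ∀ s → ¬ (s ≡ 0F) → UStep (into s) × InSupp s (proj₂ (proj₂ (into s)))
  exists 0F s≢0 = contradiction refl s≢0
  exists 1F _   = 0-α-1 , supp-dirac {7} 1F
  exists 2F _   = 0-δ-2 , supp-dirac {7} 2F
  exists 3F _   = 0-β-3 , supp-dirac {7} 3F
  exists 4F _   = 1-β-4 , supp-dirac {7} 4F
  exists 5F _   = 2-β-5 , supp-dirac {7} 5F
  exists 6F _   = 2-γ-6 , supp-dirac {7} 6F

  incoming : ∀ s → ¬ (s ≡ 0F) → Σ (Trans 7) λ t → t ∈ trans U × InSupp s (proj₂ (proj₂ t)) ×
             (∀ {t'} → t' ∈ trans U → InSupp s (proj₂ (proj₂ t')) → t' ≡ t)
  incoming s s≢0 with exists s s≢0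
  ... | step , 0<μ = into s , uStep∈ step , 0<μ , unique ∘ uStep

exec-refl : ∀ L → ExecMapping L L
exec-refl L = (λ s → s) , refl , λ c a μ c∈ → μ , c∈ , (λ _ _ _ _ eq → eq) , (λ _ _ → refl)

-- The target as a specification

noBranch βBranch βγBranch rootBranch rootBranch⁺ : Action → Maybe Spec

noBranch _ = nothing

βBranch β = just (spec noBranch)
βBranch _ = nothing

βγBranch β = just (spec noBranch)
βγBranch γ = just (spec noBranch)
βγBranch _ = nothing

rootBranch α = just (spec βBranch)
rootBranch β = just (spec noBranch)
rootBranch δ = just (spec βγBranch)
rootBranch _ = nothing

-- Permitting γ after α gives the behaviour of `F p` from its root as long as the α-loop is not
-- taken.
rootBranch⁺ α = just (spec βγBranch)
rootBranch⁺ a = rootBranch a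

rootSpec rootSpec⁺ : Spec
rootSpec  = spec rootBranch
rootSpec⁺ = spec rootBranch⁺

rejects⁺⇒rejects : ∀ w → Rejects rootSpec⁺ w → Rejects rootSpec w
rejects⁺⇒rejects ((α , _) ∷ (α , _) ∷ w)                       _   = tt
rejects⁺⇒rejects ((α , _) ∷ (β , _) ∷ w)                       rej = rej
rejects⁺⇒rejects ((α , _) ∷ (γ , _) ∷ w)                       _   = tt
rejects⁺⇒rejects ((α , _) ∷ (suc (suc (suc _)) , _) ∷ w)       _   = tt
rejects⁺⇒rejects ((suc a , _) ∷ w)                             rej = rej

branchOf : Fin 7 → Action → Maybe Spec
branchOf 0F = rootBranch
branchOf 1F = βBranch
branchOf 2F = βγBranch
branchOf _  = noBranch

specOf : Fin 7 → Spec
specOf u = spec (branchOf u)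

-- `U` performs all that its specification permits; this is what turns obeying the specification
-- into being simulated by `U`.
branch⇒step : ∀ u a {φ} → branchOf u a ≡ just φ → ∃ λ v → UStep (u , a , dirac v) × specOf v ≡ φ
branch⇒step 0F α refl = 1F , 0-α-1 , refl
branch⇒step 0F β refl = 3F , 0-β-3 , refl
branch⇒step 0F δ refl = 2F , 0-δ-2 , refl
branch⇒step 1F β refl = 4F , 1-β-4 , refl
branch⇒step 2F β refl = 5F , 2-β-5 , refl
branch⇒step 2F γ refl = 6F , 2-γ-6 , refl

U-closed : Closed U (λ u φ → specOf u ≡ φ)
U-closed {u = s} refl t∈ 0<μ with uStep t∈
... | 0-α-1 with refl ← supp-point s 1F 1ℚ 0<μ = _ , refl , refl
... | 0-β-3 with refl ← supp-point s 3F 1ℚ 0<μ = _ , refl , refl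
... | 0-δ-2 with refl ← supp-point s 2F 1ℚ 0<μ = _ , refl , refl
... | 1-β-4 with refl ← supp-point s 4F 1ℚ 0<μ = _ , refl , refl
... | 2-β-5 with refl ← supp-point s 5F 1ℚ 0<μ = _ , refl , refl
... | 2-γ-6 with refl ← supp-point s 6F 1ℚ 0<μ = _ , refl , refl

rejected⇒⋠U : ∀ L {w} → Run L (start L) w → Rejects rootSpec w → ¬ (L ≼ U)
rejected⇒⋠U L r rej (R , sim , Rs) =
  simulated-run-accepted L U sim rootSpec Rs (closed⇒below U U-closed rootSpec refl) r rej

-- All moves of `U` are Dirac, so the lifting only asks that each successor in the support obey the
-- specification of the one target state.
below⇒≼U : ∀ L → Below L rootSpec (start L) → L ≼ U
below⇒≼U L below = (λ s u → Below L (specOf u) s) , sim , below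
  where
  sim : IsStrongSim L U (λ s u → Below L (specOf u) s)
  sim s u rel a μ s∈ with dist-nonempty μ (dist-of L s∈)
  ... | s' , 0<μ with branchOf u a in eq | rel a μ
  ... | nothing | rel' = ⊥-elim (rel' s' s∈ 0<μ)
  ... | just φ  | rel' with branch⇒step u a eq
  ... | v , u∈ , refl = dirac v , uStep∈ u∈ ,
    lift-to-dirac {R = λ s u → Below L (specOf u) s} v μ (dist-of L s∈) (λ s' → rel' s' s∈)

-- LPTSes above the target

module _ (L : LPTS) where

  private
    Doesβ Doesβγ DoesRoot : Fin (nStates L) → Set
    Doesβ    s = Can L β Anything s
    Doesβγ   s = Can L β Anything s × Can L γ Anything s
    DoesRoot s = Can L α Doesβ s × Can L β Anything s × Can L δ Doesβγ s

  -- `U` has depth two, so lying above it amounts to a finite condition on moves, which is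
  -- decidable; `≼` itself quantifies over relations.
  Above : Fin 7 → Fin (nStates L) → Set
  Above 0F = DoesRoot
  Above 1F = Doesβ
  Above 2F = Doesβγ
  Above _  = Anything

  above? : ∀ s → Dec (Above 0F s)
  above? s = can? L α doesβ? s ×-dec can? L β anything? s ×-dec
             can? L δ (λ u → doesβ? u ×-dec can? L γ anything? u) s
    where
    doesβ? : ∀ u → Dec (Doesβ u)
    doesβ? = can? L β anything?

  above⇒U≼ : Above 0F (start L) → U ≼ L
  above⇒U≼ above = Above , sim , above
    where
    answer : ∀ v {a s} → Can L a (Above v) s →
             Σ (Dist (nStates L)) λ μ → (s , a , μ) ∈ trans L × LiftRel Above (dirac v) μ
    answer v (μ , s∈ , all) = μ , s∈ , lift-from-dirac {R = Above} v μ (dist-of L s∈) all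

    sim : IsStrongSim U L Above
    sim u s above a μ u∈ with uStep u∈
    ... | 0-α-1 = answer 1F (proj₁ above)
    ... | 0-β-3 = answer 3F (proj₁ (proj₂ above))
    ... | 0-δ-2 = answer 2F (proj₂ (proj₂ above))
    ... | 1-β-4 = answer 4F above
    ... | 2-β-5 = answer 5F (proj₁ above)
    ... | 2-γ-6 = answer 6F (proj₂ above)

  U≼⇒above : U ≼ L → Above 0F (start L)
  U≼⇒above (R , sim , Rs) =
    weaken {P = R 1F} doesβ (can 1F Rs 0-α-1) , any (R 3F) (can 3F Rs 0-β-3) ,
    weaken {P = R 2F} (λ Rs' → any (R 5F) (can 5F Rs' 2-β-5) , any (R 6F) (can 6F Rs' 2-γ-6)) (can 2F Rs 0-δ-2)
    where
    can : ∀ {u s a} v → R u s → UStep (u , a , dirac v) → Can L a (R v) s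
    can v Rus u∈ = simulated-can U L sim v Rus (uStep∈ u∈)

    weaken : ∀ {a P Q s} → (∀ {u} → P u → Q u) → Can L a P s → Can L a Q s
    weaken P⇒Q (μ , s∈ , all) = μ , s∈ , λ u 0<μ → P⇒Q (all u 0<μ)

    any : ∀ {a s} P → Can L a P s → Can L a Anything s
    any P = weaken {P = P} _

    doesβ : ∀ {s} → R 1F s → Doesβ s
    doesβ Rs' = any (R 4F) (can 4F Rs' 1-β-4)

-- The three-state approximations of the target

split : ℚ → Dist 3
split p = p ∷ 1ℚ - p ∷ 0ℚ ∷ []

abstract
  split-dist : ∀ {p} → 0ℚ < p → p < 1ℚ → IsDist (split p)
  split-dist {p} 0<p p<1 = nonneg , (begin
    p + (1ℚ - p + 0ℚ)  ≡⟨ cong (p +_) (ℚₚ.+-identityʳ _) ⟩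
    p + (1ℚ - p)       ≡⟨ ℚₚ.+-comm p _ ⟩
    1ℚ - p + p         ≡⟨ ℚₚ.+-assoc 1ℚ (- p) p ⟩
    1ℚ + (- p + p)     ≡⟨ cong (1ℚ +_) (ℚₚ.+-inverseˡ p) ⟩
    1ℚ                 ∎)
    where
    open ≡-Reasoning
    nonneg : ∀ s → 0ℚ ≤ lookup (split p) s
    nonneg 0F = ℚₚ.<⇒≤ 0<p
    nonneg 1F = subst (_≤ 1ℚ - p) (ℚₚ.+-inverseʳ p) (ℚₚ.+-mono-≤ (ℚₚ.<⇒≤ p<1) (ℚₚ.≤-refl { - p}))
    nonneg 2F = ℚₚ.≤-refl

module _ {p : ℚ} (0<p : 0ℚ < p) (p<1 : p < 1ℚ) where

  F : LPTS
  F = lpts 3 0F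
    ((0F , α , split p) ∷ (0F , β , dirac 2F) ∷ (0F , δ , dirac 1F) ∷
     (1F , β , dirac 2F) ∷ (1F , γ , dirac 2F) ∷ [])
    (split-dist 0<p p<1 ∷ dirac-dist 2F ∷ dirac-dist 1F ∷ dirac-dist 2F ∷ dirac-dist 2F ∷ [])

  private
    data FStep : Trans 3 → Set where
      0-α-split : FStep (0F , α , split p)
      0-β-2     : FStep (0F , β , dirac 2F)
      0-δ-1     : FStep (0F , δ , dirac 1F)
      1-β-2     : FStep (1F , β , dirac 2F)
      1-γ-2     : FStep (1F , γ , dirac 2F)

    fStep : ∀ {t} → t ∈ trans F → FStep t
    fStep (here refl)                                 = 0-α-split
    fStep (there (here refl))                         = 0-β-2
    fStep (there (there (here refl)))                 = 0-δ-1
    fStep (there (there (there (here refl))))         = 1-β-2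
    fStep (there (there (there (there (here refl))))) = 1-γ-2

  -- The α-successor of the root of `U` only has to do β, and both states 0 and 1 of `F`, between
  -- which α splits, do so.
  U≼F : U ≼ F
  U≼F = above⇒U≼ F
    ( (split p , here refl , λ { 0F _   → _ , there (here refl) , _
                               ; 1F _   → doesβ
                               ; 2F 0<0 → contradiction 0<0 (ℚₚ.<-irrefl refl) })
    , (_ , there (here refl) , _)
    , (dirac 1F , there (there (here refl)) , λ
        { 0F 0<0 → contradiction 0<0 (ℚₚ.<-irrefl refl)
        ; 1F _   → doesβ , (_ , there (there (there (there (here refl)))) , _)
        ; 2F 0<0 → contradiction 0<0 (ℚₚ.<-irrefl refl) }))
    where
    doesβ : Can F β Anything 1F
    doesβ = _ , there (there (there (here refl))) , _

  private
    -- State 0 is left out: its loop allows arbitrarily many α, more than any specification of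
    -- finite depth.
    data FSpec : Fin 3 → Spec → Set where
      spec₁ : FSpec 1F (spec βγBranch)
      spec₂ : FSpec 2F (spec noBranch)

    F-closed : Closed F FSpec
    F-closed {u = u} spec₁ t∈ 0<μ with fStep t∈
    ... | 1-β-2 with refl ← supp-point {3} u 2F 1ℚ 0<μ = _ , refl , spec₂
    ... | 1-γ-2 with refl ← supp-point {3} u 2F 1ℚ 0<μ = _ , refl , spec₂
    F-closed spec₂ t∈ 0<μ with () ← fStep t∈

    F-below : ∀ {φ s} → FSpec s φ → Below F φ s
    F-below = closed⇒below F F-closed _

  module _ (T : LPTS) (T≼F : T ≼ F) where

    private
      R   = proj₁ T≼F
      sim = proj₁ (proj₂ T≼F)
      Rs  = proj₂ (proj₂ T≼F)

      accepted : ∀ {s u φ w} → R s u → FSpec u φ → Run T s w → ¬ Rejects φ w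
      accepted Rsu S = simulated-run-accepted T F sim _ Rsu (F-below S)

      ≢2 : ∀ {u} → InSupp u (split p) → u ≢ 2F
      ≢2 0<0 refl = ℚₚ.<-irrefl refl 0<0

    -- F can follow such a run only through its loop at the root, which has probability p.
    rejected⁺⇒≤p : ∀ {a q w} → Run T (start T) ((a , q) ∷ w) →
                   Rejects rootSpec⁺ ((a , q) ∷ w) → q ≤ p
    rejected⁺⇒≤p (move {μ = μ} {s' = s'} t∈ 0<μ refl r) rej with sim _ _ Rs _ μ t∈
    ... | μ₂ , u∈ , lift with fStep u∈
    -- After α the remaining trace is rejected by `βγBranch`, which state 1 obeys, so the mass of
    -- `s'` can go to state 0 only.
    ... | 0-α-split = lift-mass {R = R} {μ} {split p} lift λ
      { 0F _   _    → refl
      ; 1F _   Rs'1 → contradiction rej (accepted Rs'1 spec₁ r)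
      ; 2F 0<0 _    → contradiction refl (≢2 0<0) }
    -- After β or δ there is no loop: the run must continue from state 2 or 1, whose specification
    -- accepts the rest.
    ... | 0-β-2 with u , 0<u , Rs'u ← lift-right {R = R} {μ} {dirac 2F} lift 0<μ
                with refl ← supp-point {3} u 2F 1ℚ 0<u = contradiction rej (accepted Rs'u spec₂ r)
    ... | 0-δ-1 with u , 0<u , Rs'u ← lift-right {R = R} {μ} {dirac 1F} lift 0<μ
                with refl ← supp-point {3} u 1F 1ℚ 0<u = contradiction rej (accepted Rs'u spec₁ r)

    -- Of the two α-successors only state 1, of probability `1 - p`, does γ, so the state reached by
    -- the first step can be matched there alone.
    αγ-run⇒≤1-p : ∀ {q q' w} → Run T (start T) ((α , q) ∷ (γ , q') ∷ w) → q ≤ 1ℚ - p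
    αγ-run⇒≤1-p (move {μ = μ} t∈ 0<μ refl (move {μ = μ'} t'∈ _ _ _)) with sim _ _ Rs _ μ t∈
    ... | μ₂ , u∈ , lift with fStep u∈
    ... | 0-α-split = lift-mass {R = R} {μ} {split p} lift λ
      { 0F _   Rs'0 → ⊥-elim (no-γ Rs'0)
      ; 1F _   _    → refl
      ; 2F 0<0 _    → contradiction refl (≢2 0<0) }
      where
      no-γ : ¬ R _ 0F
      no-γ Rs'0 with sim _ _ Rs'0 _ μ' t'∈
      ... | _ , u'∈ , _ with () ← fStep u'∈

-- Runs that rule out small loop probabilities

data Lethal : Trace → Set where
  rejected⁺ : ∀ {w} → Rejects rootSpec⁺ w → Lethal w
  certain   : ∀ {q q' w} → q ≡ 1ℚ → Lethal ((α , q) ∷ (γ , q') ∷ w)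

-- For a rejected run the threshold is the probability of its first step, positive because the step
-- stays in the support. For a certain αγ-run every `p` in range works, as `1 - p` is less than 1.
lethal⇒⋠F : ∀ T {w} → Run T (start T) w → Lethal w →
            ∃ λ q → 0ℚ < q × (∀ p (0<p : 0ℚ < p) (p<1 : p < 1ℚ) → p < q → ¬ (T ≼ F 0<p p<1))
lethal⇒⋠F T {(a , q) ∷ w} r@(move _ 0<μ refl _) (rejected⁺ rej) =
  q , 0<μ , λ p 0<p p<1 p<q T≼F → <⇒≱ p<q (rejected⁺⇒≤p 0<p p<1 T T≼F r rej)
lethal⇒⋠F T halt (rejected⁺ ())
lethal⇒⋠F T r (certain q≡1) =
  1ℚ , 0<1 , λ p 0<p p<1 _ T≼F →
    <⇒≱ (1-p<1 0<p) (subst (_≤ 1ℚ - p) q≡1 (αγ-run⇒≤1-p 0<p p<1 T T≼F r))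
  where
  1-p<1 : ∀ {p} → 0ℚ < p → 1ℚ - p < 1ℚ
  1-p<1 {p} 0<p = subst (1ℚ - p <_) (ℚₚ.+-identityʳ 1ℚ) (ℚₚ.+-monoʳ-< 1ℚ (ℚₚ.neg-antimono-< 0<p))

-- In a hypothesis with at most three states above U whose runs satisfy rootSpec⁺, the root,
-- a δ-successor of the root and a β-successor of the latter are distinct, so that they exhaust
-- the states and an α-successor doing β can only be the δ-successor.
α-succ≡δ-succ : ∀ L {h s y} → nStates L ℕ.≤ 3 →
  Below L (spec βγBranch) s → Can L β Anything s →
  Below L (spec βγBranch) y → Can L β Anything y → Can L α Anything h → s ≡ y
α-succ≡δ-succ L {h} {s} {y} n≤3 below-s s-β below-y y-β@(μ , y∈ , _) h-α =
  conclude (Finₚ.pigeonhole (ℕ.s≤s n≤3) states)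
  where
  z∈ = dist-nonempty μ (dist-of L y∈)
  z  = proj₁ z∈

  no-α : ∀ {u} → Below L (spec βγBranch) u → ¬ Can L α Anything u
  no-α below = below-forbids L βγBranch below refl

  below-z : Below L (spec noBranch) z
  below-z = below-y β μ z y∈ (proj₂ z∈)

  states : Fin 4 → Fin (nStates L)
  states 0F = h
  states 1F = y
  states 2F = z
  states 3F = s

  separated : ∀ {a u v} → Can L a Anything u → ¬ Can L a Anything v → u ≢ v
  separated can-u ¬can-v refl = ¬can-v can-u

  -- Among four states of which at most three are distinct two coincide. Only `h` does α, and `y`
  -- and `s` do β while `z` does nothing, which leaves `y ≡ s`; the pairs listed last violate the
  -- ordering of the indices.
  conclude : (∃ λ i → ∃ λ j → i Fin.< j × states i ≡ states j) → s ≡ y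
  conclude (0F , 1F , _ , h≡y) = contradiction h≡y (separated h-α (no-α below-y))
  conclude (0F , 2F , _ , h≡z) = contradiction h≡z (separated h-α (below-forbids L noBranch below-z refl))
  conclude (0F , 3F , _ , h≡s) = contradiction h≡s (separated h-α (no-α below-s))
  conclude (1F , 2F , _ , y≡z) = contradiction y≡z (separated y-β (below-forbids L noBranch below-z refl))
  conclude (1F , 3F , _ , y≡s) = sym y≡s
  conclude (2F , 3F , _ , z≡s) = contradiction (sym z≡s) (separated s-β (below-forbids L noBranch below-z refl))
  conclude (0F , 0F , () , _)
  conclude (1F , 0F , () , _)
  conclude (1F , 1F , ℕ.s≤s () , _)
  conclude (2F , 0F , () , _)
  conclude (2F , 1F , ℕ.s≤s () , _)
  conclude (2F , 2F , ℕ.s≤s (ℕ.s≤s ()) , _)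
  conclude (3F , 0F , () , _)
  conclude (3F , 1F , ℕ.s≤s () , _)
  conclude (3F , 2F , ℕ.s≤s (ℕ.s≤s ()) , _)
  conclude (3F , 3F , ℕ.s≤s (ℕ.s≤s (ℕ.s≤s ())) , _)

-- The teacher

-- Lethality is demanded for at most three states only: larger hypotheses still need a valid answer,
-- but a minimal learner is kept from them.
data Verdict (H : LPTS) : Set where
  incomplete : ¬ Above H 0F (start H) → Verdict H
  refuted    : ∀ {w} → Run H (start H) w → Rejects rootSpec w →
               (nStates H ℕ.≤ 3 → Lethal w) → Verdict H
  equivalent : Above H 0F (start H) → Below H rootSpec (start H) → ¬ (nStates H ℕ.≤ 3) → Verdict H

-- Violations of rootSpec⁺, which tolerates αγ, are sought first: the unfolding along an αγ-run is
-- of use only if its first step has probability 1, and this relies on rootSpec⁺ being satisfied.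
verdict : ∀ H → Verdict H
verdict H with above? H (start H)
... | no ¬above = incomplete ¬above
... | yes above@((μ , h∈ , all-β) , _ , (μ' , h'∈ , all-βγ)) with search H rootSpec⁺ (start H)
...   | inj₁ (w , r , rej) = refuted r (rejects⁺⇒rejects w rej) (λ _ → rejected⁺ rej)
...   | inj₂ below = choose (can? H γ anything? s)
  where
  s∈ = dist-nonempty μ (dist-of H h∈)
  s  = proj₁ s∈
  y∈ = dist-nonempty μ' (dist-of H h'∈)
  y  = proj₁ y∈

  succ≡y : nStates H ℕ.≤ 3 → ∀ u → InSupp u μ → u ≡ y
  succ≡y n≤3 u 0<u = α-succ≡δ-succ H n≤3
    (below α μ u h∈ 0<u) (all-β u 0<u)
    (below δ μ' y h'∈ (proj₂ y∈)) (proj₁ (all-βγ y (proj₂ y∈))) (μ , h∈ , _)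

  -- With at most three states the α-successor `s` would be the δ-successor `y`, which does γ.
  too-many : ¬ Can H γ Anything s → ¬ (nStates H ℕ.≤ 3)
  too-many ¬γ n≤3 = ¬γ (subst (Can H γ Anything) (sym (succ≡y n≤3 s (proj₂ s∈)))
                              (proj₂ (all-βγ y (proj₂ y∈))))

  choose : Dec (Can H γ Anything s) → Verdict H
  choose (yes (ν , s-γ , _)) with dist-nonempty ν (dist-of H s-γ)
  ... | u , 0<ν = refuted (move h∈ (proj₂ s∈) refl (move s-γ 0<ν refl halt)) tt λ n≤3 →
    -- All α-successors under `μ` equal `y`, so `s` carries the entire mass.
    certain (dist-singleton μ (dist-of H h∈) λ u 0<u →
      ≡-trans (succ≡y n≤3 u 0<u) (sym (succ≡y n≤3 s (proj₂ s∈))))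
  -- Other α-moves of `H` may still allow a run outside `rootSpec`. Whatever is found, `H` has more
  -- than three states, so no lethality is owed.
  choose (no ¬γ) with search H rootSpec (start H)
  ... | inj₁ (w , r , rej) = refuted r rej (⊥-elim ∘ too-many ¬γ)
  ... | inj₂ below⁻        = equivalent above below⁻ (too-many ¬γ)

-- The case analysis of the teacher is reused: the first two verdicts contradict equivalence, and
-- the third carries the bound.
≃U⇒≰3 : ∀ H → H ≃ₛ U → ¬ (nStates H ℕ.≤ 3)
≃U⇒≰3 H (H≼U , U≼H) with verdict H
... | incomplete ¬above = contradiction (U≼⇒above H U≼H) ¬above
... | refuted r rej _   = contradiction H≼U (rejected⇒⋠U H r rej)
... | equivalent _ _ ≰3 = ≰3

-- Consistency of the approximations with the history

SmallPConsistent : ℚ → Polarity × LPTS → Set₁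
SmallPConsistent q c = ∀ p (0<p : 0ℚ < p) (p<1 : p < 1ℚ) → p < q → ConsistentWith (F 0<p p<1) c

abstract
  respond : LPTS → Response
  respond H with verdict H
  ... | incomplete _     = cex positive U
  ... | refuted r _ _    = cex negative (Spine.tree (unfoldAlong H r))
  ... | equivalent _ _ _ = confirm

  respond-valid : ∀ H → ValidFriendlyResponse U H (respond H)
  respond-valid H with verdict H
  ... | incomplete ¬above = U-isTree , exec⇒≼ U U (exec-refl U) , ¬above ∘ U≼⇒above H , exec-refl U
  ... | refuted r rej _   = isTree , exec⇒≼ tree H exec , rejected⇒⋠U tree spineRun rej , exec
    where
    open Spine (unfoldAlong H r)
    exec : ExecMapping tree H
    exec = M , M-start , M-step
  ... | equivalent above below _ = below⇒≼U H below , above⇒U≼ H above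

  -- The positive counterexample `U` lies below every `F p`, and a negative one unfolds a lethal
  -- run.
  respond-harmless : ∀ H → nStates H ℕ.≤ 3 → ∀ {pol C} → respond H ≡ cex pol C →
                     ∃ λ q → 0ℚ < q × SmallPConsistent q (pol , C)
  respond-harmless H n≤3 eq with verdict H
  respond-harmless H n≤3 refl | incomplete _ = 1ℚ , 0<1 , λ _ 0<p p<1 _ → U≼F 0<p p<1
  respond-harmless H n≤3 refl | refuted r _ lethal =
    lethal⇒⋠F tree spineRun (lethal n≤3)
    where open Spine (unfoldAlong H r)

-- The fold discards its accumulator, so only the last hypothesis counts; `confirm` is the value at
-- the empty list, which never arises in an interaction.
teacher : Teacher
teacher = foldl (λ _ → respond) confirm

teacher-∷ʳ : ∀ hs H → teacher (hs ∷ʳ H) ≡ respond H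
teacher-∷ʳ hs H = foldl-∷ʳ (λ _ → respond) confirm H hs

teacher-friendly : ∀ L → FriendlyTeacherFor L teacher U
teacher-friendly L n cs hs _ =
  subst (ValidFriendlyResponse U (L cs)) (sym (teacher-∷ʳ hs (L cs))) (respond-valid (L cs))

step-going : ∀ L st {cs' hs'} → step L teacher st ≡ going cs' hs' →
             ∃ λ cs → ∃ λ hs → ∃ λ pol → ∃ λ C →
               st ≡ going cs hs × respond (L cs) ≡ cex pol C × cs' ≡ cs ∷ʳ (pol , C)
step-going L (going cs hs) eq with teacher (hs ∷ʳ L cs) in resp
step-going L (going cs hs) refl | cex pol C =
  cs , hs , pol , C , refl , ≡-trans (sym (teacher-∷ʳ hs (L cs))) resp , refl

0<⊓ : ∀ {q r} → 0ℚ < q → 0ℚ < r → 0ℚ < q ⊓ r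
0<⊓ {q} {r} 0<q 0<r with ℚₚ.⊓-sel q r
... | inj₁ eq = subst (0ℚ <_) (sym eq) 0<q
... | inj₂ eq = subst (0ℚ <_) (sym eq) 0<r

shrink : ∀ {q r c} → r ≤ q → SmallPConsistent q c → SmallPConsistent r c
shrink r≤q c p 0<p p<1 p<r = c p 0<p p<1 (ℚₚ.<-≤-trans p<r r≤q)

-- One threshold serves the whole history, as the minimum of finitely many positive ones. The bound
-- by 1 makes every `p` below it a legitimate loop probability.
Harmless : History → Set₁
Harmless cs = ∃ λ q → 0ℚ < q × q ≤ 1ℚ × All (SmallPConsistent q) cs

harmless-∷ʳ : ∀ {cs c} → Harmless cs → (∃ λ q → 0ℚ < q × SmallPConsistent q c) →
              Harmless (cs ∷ʳ c)
harmless-∷ʳ (q , 0<q , q≤1 , ok) (q' , 0<q' , ok') =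
  q ⊓ q' , 0<⊓ 0<q 0<q' , ℚₚ.≤-trans (ℚₚ.p⊓q≤p q q') q≤1 ,
  Allₚ.∷ʳ⁺ (All.map (shrink (ℚₚ.p⊓q≤p q q')) ok) (shrink (ℚₚ.p⊓q≤q q q') ok')

-- By density some `p` lies strictly between 0 and the threshold, and `F p` is then a consistent
-- competitor with three states.
harmless⇒≤3 : ∀ {H cs} → MinimalConsistent H cs → Harmless cs → nStates H ℕ.≤ 3
harmless⇒≤3 (_ , minimal) (q , 0<q , q≤1 , ok) with ℚₚ.<-dense 0<q
... | p , 0<p , p<q = minimal (F 0<p p<1) (All.map (λ c → c p 0<p p<1 p<q) ok)
  where
  p<1 = ℚₚ.<-≤-trans p<q q≤1

module _ (L : Learner) (minimality : SatisfiesMinimality L) where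

  private
    minimal : ∀ n cs hs → run L teacher n ≡ going cs hs → MinimalConsistent (L cs) cs
    minimal = minimality U teacher (teacher-friendly L)

  -- Harmlessness of the earlier history bounds the current hypothesis by three states, and this
  -- bound makes the next counterexample harmless too.
  history-harmless : ∀ n cs hs → run L teacher n ≡ going cs hs → Harmless cs
  history-harmless zero    _   _   refl = 1ℚ , 0<1 , ℚₚ.≤-refl , []
  history-harmless (suc n) cs' hs' eq with step-going L (run L teacher n) eq
  ... | cs , hs , pol , C , running , resp , refl =
    harmless-∷ʳ harmless (respond-harmless (L cs) (harmless⇒≤3 (minimal n cs hs running) harmless) resp)
    where
    harmless = history-harmless n cs hs running

  hypotheses≤3 : ∀ n cs hs → run L teacher n ≡ going cs hs → nStates (L cs) ℕ.≤ 3
  hypotheses≤3 n cs hs running =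
    harmless⇒≤3 (minimal n cs hs running) (history-harmless n cs hs running)

theorem6 : ¬ (Σ Learner λ L → SatisfiesMinimality L × LearnsAll L)
theorem6 (L , minimality , learns) with learns U teacher (teacher-friendly L)
... | n , cs , hs , running , L≃U =
  ≃U⇒≰3 (L cs) L≃U (hypotheses≤3 L minimality n cs hs running)
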